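{- Let $V=(v_{ij})\in(\mathbb R\cup\{\infty\})^{d\times n}$ be a matrix none of whose columns is identically $\infty$, and let $\Psi$ be a subgraph of the complete bipartite graph $[d]\times[n]$. The signed cells $\overline{\operatorname{thalf}}(V,\Psi_\epsilon)/\mathbb R\mathbf 1$, where $\epsilon$ ranges over all sign vectors in $\{+,-\}^n$, generate a piecewise linear decomposition of $\mathbb{TP}_{\min}^{d-1}$. Furthermore, a cell with graph $G$ in the covector decomposition of $\mathbb{TP}_{\min}^{d-1}$ by $V$ is contained in $\overline{\operatorname{thalf}}(V,\Psi_\epsilon)$ if and only if $\Psi_\epsilon\cap G$ has no isolated node in $[n]$.
   Context: $\mathbb T_{\min}=\mathbb R\cup\{\infty\}$; $\mathbb{TP}_{\min}^{d-1}$ is the quotient of $\mathbb T_{\min}^d\setminus\{(\infty,\dots,\infty)\}$ by $\mathbb R\mathbf 1$. Subgraphs of $[d]\times[n]$ are identified with arc sets; $v^{(j)}$ is the $j$th column of $V$. For $u\in\mathbb T_{\min}^d$, $\operatorname{supp}(u)=\{i:u_i\ne\infty\}$. Sectors: for $i\in\operatorname{supp}(u)$, $S_i(u)=\{z\in\mathbb R^d : z_\ell-z_i\le u_\ell-u_i\text{ for all }\ell\in\operatorname{supp}(u)\}$. For $K\subseteq[d]$ let $b^{(K)}\in\mathbb T_{\min}^d$ have $i$th entry $\infty$ if $i\in K$ and $0$ otherwise. Put $$\overline{S_i(u)}=S_i(u)\cup\bigcup_{K\in\mathcal K}\bigl(b^{(K)}+S_i(u)\bigr),$$ where $\mathcal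 K=\{A\cup B : A\in\mathcal A,\ B\in\mathcal B\}$, $\mathcal A=\{\emptyset\}\cup\{M\cup\{i\} : M\subseteq\operatorname{supp}(u)\}$, $\mathcal B=\{M : M\subseteq[d]\setminus\operatorname{supp}(u)\}$, and $+$ is elementwise addition. These sets are viewed modulo $\mathbb R\mathbf 1$ as subsets of $\mathbb{TP}_{\min}^{d-1}$ (discarding the all-$\infty$ vector). For $i\notin\operatorname{supp}(u)$ set $\overline{S_i(u)}=\emptyset$. For a subgraph $\Phi\subseteq[d]\times[n]$ put $\overline{\operatorname{thalf}}(V,\Phi)=\bigcap_{j\in[n]}\bigcup_{i:(i,j)\in\Phi}\overline{S_i(v^{(j)})}$. For $\epsilon\in\{+,-\}^n$ let $\Psi_\epsilon=\{(i,j)\in[d]\times[n] : ((i,j)\in\Psi\text{ and }\epsilon_j=+)\text{ or }((i,j)\notin\Psi\text{ and }\epsilon_j=-)\}$. A nonempty set $\overline{\operatorname{thalf}}(V,\Psi_\epsilon)$, as a subset of $\mathbb{TP}_{\min}^{d-1}$, is called a signed cell. Covector decomposition of $\mathbb{TP}_{\min}^{d-1}$ by $V$: the sectors $S_i(u)$, $i\in\operatorname{supp}(u)$, are the maximal cells of a polyhedral complex $\Delta(u)$ covering $\mathbb R^d$ (its cells are intersections of nonempty families of sectors of $u$), and the covector decomposition of $\mathbb R^d$ by a matrix is the common refinement of the complexes of its columns (the single cell $\mathbb R^d$ if there are no columns). For a proper subset $Z\subsetneq[d]$ let $V(Z)$ be obtained from $V$ by removing all columns $j$ having a finite entry $v_{ij}$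 with $i\in Z$ and then removing the rows in $Z$; its covector decomposition of $\mathbb R^{[d]\setminus Z}/\mathbb R\mathbf 1$ decomposes the stratum $\{p : p_i=\infty\text{ iff }i\in Z\}$. The cells of all these decompositions, over all $Z$, are the cells of the covector decomposition of $\mathbb{TP}_{\min}^{d-1}$. The graph $G$ of such a cell $C$ is the set of all $(i,j)\in[d]\times[n]$ with $v_{ij}\neq\infty$ and $C\subseteq\overline{S_i(v^{(j)})}$. "Generate a piecewise linear decomposition" means: the signed cells cover $\mathbb{TP}_{\min}^{d-1}$, and each signed cell (hence also each intersection of signed cells) is a union of cells of the covector decomposition of $\mathbb{TP}_{\min}^{d-1}$ by $V$. -}

module Defs where

open import Algebra.Bundles using (CommutativeRing)
open import Data.Bool.Base using (if_then_else_)
open import Data.Fin.Base using (Fin)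
open import Data.Fin.Subset as Subset using (Subset; ⊤; ⊥; ⁅_⁆)
open import Data.Fin.Subset.Properties using (_∈?_)
open import Data.Irrelevant using ([_])
open import Data.Maybe.Base using (zipWith)
open import Data.Nat.Base using (ℕ)
open import Data.Product.Base using (Σ-syntax; ∃; ∃-syntax; _×_; _,_)
open import Data.Refinement.Base using (Refinement; value; _,_)
open import Data.Sign.Base as Sign using (Sign)
open import Data.Sum.Base using (_⊎_)
open import Data.Vec.Base using (lookup)
open import Data.Vec.Functional using (Vector)
open import Function.Base using (_∘_)
open import Level using (Level; 0ℓ; suc; _⊔_)
open import Relation.Binary.Core using (Rel)
open import Relation.Binary.PropositionalEquality.Core using (_≡_; _≢_)
open import Relation.Binary.Structures using (IsDecTotalOrder)
open import Relation.Nullary using (¬_; yes; no)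
open import Relation.Nullary.Construct.Add.Supremum
  using (_⁺) renaming ([_] to fin; ⊤⁺ to ∞)
open import Relation.Unary
  using (Pred; _∈_; _∉_; _⊆_; _≐_; _∪_; ⋃; ⋂; Satisfiable)
import Relation.Binary.Construct.Add.Supremum.Equality as SupremumEquality

-- The classical axioms of ℝ: a Dedekind-complete ordered field, whose order is
-- total and decidable.

record RealNumbers : Set₁ where
  infix 4 _≤_
  field
    commutativeRing : CommutativeRing 0ℓ 0ℓ
  open CommutativeRing commutativeRing public
  field
    _≤_             : Rel Carrier 0ℓ
    isDecTotalOrder : IsDecTotalOrder _≈_ _≤_
    0≉1             : ¬ 0# ≈ 1#
    inverse         : ∀ x → ¬ x ≈ 0# → ∃[ y ] x * y ≈ 1#
    +-monoʳ-≤       : ∀ x {y z} → y ≤ z → x + y ≤ x + z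
    *-nonNegative   : ∀ {x y} → 0# ≤ x → 0# ≤ y → 0# ≤ x * y

  UpperBound : Pred Carrier 0ℓ → Pred Carrier 0ℓ
  UpperBound P b = ∀ {x} → x ∈ P → x ≤ b

  field
    complete : ∀ P → Satisfiable P → Satisfiable (UpperBound P) →
               ∃[ s ] s ∈ UpperBound P × (∀ {b} → b ∈ UpperBound P → s ≤ b)

Graph : ℕ → ℕ → Set₁
Graph d n = Pred (Fin d × Fin n) 0ℓ

NoIsolatedNode : ∀ {d n} → Graph d n → Set
NoIsolatedNode Φ = ∀ j → ∃[ i ] (i , j) ∈ Φ

signed : ∀ {d n} → Graph d n → Vector Sign n → Graph d n
signed Ψ ε (i , j) = ((i , j) ∈ Ψ × ε j ≡ Sign.+) ⊎ ((i , j) ∉ Ψ × ε j ≡ Sign.-)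

Collection : Set → (ℓ : Level) → Set (suc 0ℓ ⊔ suc ℓ)
Collection A ℓ = Pred (Pred A 0ℓ) ℓ

IsUnionOf : ∀ {A : Set} {ℓ} → Collection A ℓ → Pred A 0ℓ → Set (suc 0ℓ ⊔ ℓ)
IsUnionOf {A} 𝒞 X =
  Σ[ I ∈ Set ] Σ[ C ∈ (I → Pred A 0ℓ) ] (∀ k → C k ∈ 𝒞) × X ≐ ⋃ I C

record GeneratesDecomposition {A : Set} {a b}
  (𝒮 : Collection A a) (𝒞 : Collection A b) : Set (suc 0ℓ ⊔ a ⊔ b) where
  field
    covers        : ∀ x → ∃[ S ] S ∈ 𝒮 × x ∈ S
    unions        : ∀ {S} → S ∈ 𝒮 → IsUnionOf 𝒞 S
    intersections : ∀ {I : Set} (S : I → Pred A 0ℓ) → (∀ k → S k ∈ 𝒮) →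
                    IsUnionOf 𝒞 (⋂ I S)

module Tropical (ℝ : RealNumbers) where
  open RealNumbers ℝ renaming (Carrier to R)
  open SupremumEquality _≈_ using (_≈⁺_)

  infix  4 _≋_ _∼_
  infixl 6 _⊞_ _⊕_

  T : Set
  T = R ⁺

  _⊞_ : T → T → T
  _⊞_ = zipWith _+_

  supp : ∀ {I : Set} → (I → T) → Pred I 0ℓ
  supp u i = u i ≢ ∞

  AllInfinite : ∀ {d} → Pred (Vector T d) 0ℓ
  AllInfinite x = ∀ i → x i ≡ ∞

  _≋_ : ∀ {d} → Rel (Vector T d) 0ℓ
  x ≋ y = ∀ i → x i ≈⁺ y i

  -- Equality modulo ℝ𝟏.
  _∼_ : ∀ {d} → Rel (Vector T d) 0ℓ
  x ∼ y = ∃[ c ] x ≋ (λ i → fin c ⊞ y i)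

  -- Representatives of the points of TP_min^(d-1); subsets of the quotient are
  -- predicates on representatives, produced by _/ℝ𝟏, hence closed under _∼_.
  TP : ℕ → Set
  TP d = Σ[ x ∈ Vector T d ] ¬ AllInfinite x

  _/ℝ𝟏 : ∀ {d} → Pred (Vector T d) 0ℓ → Pred (TP d) 0ℓ
  (S /ℝ𝟏) (p , _) = ∃[ x ] x ∈ S × p ∼ x

  -- Row sets are arbitrary types, since matrices lose rows below.
  -- The sector is empty when i lies outside the support.
  Sector : ∀ {I : Set} → (I → T) → I → Pred (I → R) 0ℓ
  Sector u i z =
    ∃[ a ] u i ≡ fin a × (∀ ℓ b → u ℓ ≡ fin b → z ℓ - z i ≤ b - a)

  image : ∀ {d} {A : Set} → (A → Vector T d) → Pred A 0ℓ → Pred (Vector T d) 0ℓ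
  image f S x = ∃[ z ] z ∈ S × x ≋ f z

  _⊕_ : ∀ {d} → Vector T d → Pred (Vector R d) 0ℓ → Pred (Vector T d) 0ℓ
  b ⊕ S = image (λ z i → b i ⊞ fin (z i)) S

  boundary : ∀ {d} → Subset d → Vector T d
  boundary K i = if lookup K i then ∞ else fin 0#

  𝒜 : ∀ {d} → Vector T d → Fin d → Pred (Subset d) 0ℓ
  𝒜 u i A = A ≡ ⊥ ⊎ (∃[ M ] (Subset._∈ M) ⊆ supp u × A ≡ M Subset.∪ ⁅ i ⁆)

  ℬ : ∀ {d} → Vector T d → Pred (Subset d) 0ℓ
  ℬ u B = ∀ {ℓ} → ℓ Subset.∈ B → ℓ ∉ supp u

  𝒦 : ∀ {d} → Vector T d → Fin d → Pred (Subset d) 0ℓ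
  𝒦 u i K = ∃[ A ] ∃[ B ] A ∈ 𝒜 u i × B ∈ ℬ u × K ≡ A Subset.∪ B

  ClosedSector : ∀ {d} → Vector T d → Fin d → Pred (TP d) 0ℓ
  ClosedSector u i =
    (image (fin ∘_) (Sector u i)
      ∪ ⋃ (∃ (𝒦 u i)) (λ (K , _) → boundary K ⊕ Sector u i)) /ℝ𝟏

  Matrix : Set → Set → Set
  Matrix I J = I → J → T

  column : ∀ {I J : Set} → Matrix I J → J → I → T
  column V j i = V i j

  thalf : ∀ {d n} → Matrix (Fin d) (Fin n) → Graph d n → Pred (TP d) 0ℓ
  thalf {d} {n} V Φ =
    ⋂ (Fin n) λ j → ⋃ (∃[ i ] (i , j) ∈ Φ) λ (i , _) → ClosedSector (column V j) i

  SignedCell : ∀ {d n} → Matrix (Fin d) (Fin n) → Graph d n → Collection (TP d) 0ℓ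
  SignedCell V Ψ S = Satisfiable S × ∃[ ε ] S ≐ thalf V (signed Ψ ε)

  -- The cells of Δ(u).
  SectorCell : ∀ {I : Set} → (I → T) → Collection (I → R) (suc 0ℓ)
  SectorCell {I} u D =
    Σ[ M ∈ Pred I 0ℓ ] Satisfiable M × M ⊆ supp u ×
      D ≐ ⋂ (∃ M) (λ (i , _) → Sector u i)

  -- Cells of a common refinement are nonempty.
  RefinementCell : ∀ {I J : Set} → Matrix I J → Collection (I → R) (suc 0ℓ)
  RefinementCell {I} {J} V C =
    Satisfiable C × Σ[ D ∈ (J → Pred (I → R) 0ℓ) ]
      (∀ j → D j ∈ SectorCell (column V j)) × C ≐ ⋂ J D

  Row : ∀ {d} → Subset d → Set
  Row {d} Z = Refinement (Fin d) (Subset._∉ Z)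

  Column : ∀ {d n} → Matrix (Fin d) (Fin n) → Subset d → Set
  Column {n = n} V Z =
    Refinement (Fin n) λ j → ¬ (∃[ i ] i Subset.∈ Z × V i j ≢ ∞)

  -- The matrix V(Z).
  _⟨_⟩ : ∀ {d n} (V : Matrix (Fin d) (Fin n)) (Z : Subset d) →
         Matrix (Row Z) (Column V Z)
  (V ⟨ Z ⟩) i j = V (value i) (value j)

  extend : ∀ {d} (Z : Subset d) → (Row Z → R) → Vector T d
  extend Z w i with i ∈? Z
  ... | yes _   = ∞
  ... | no  i∉Z = fin (w (i , [ i∉Z ]))

  CovectorCell : ∀ {d n} → Matrix (Fin d) (Fin n) → Collection (TP d) (suc 0ℓ)
  CovectorCell V C =
    ∃[ Z ] Z Subset.⊂ ⊤ ×
      ∃[ D ] D ∈ RefinementCell (V ⟨ Z ⟩) × C ≐ image (extend Z) D /ℝ𝟏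

  graph : ∀ {d n} → Matrix (Fin d) (Fin n) → Pred (TP d) 0ℓ → Graph d n
  graph V C (i , j) = V i j ≢ ∞ × C ⊆ ClosedSector (column V j) i

{-# OPTIONS --safe #-}
module Submission where

-- A point p lies in the closed sector of u at i iff i attains the maximum of
-- p ℓ - u ℓ over the support of u.  So every point lies in some closed sector
-- of each column (covering), and the closed sectors containing p also contain
-- its covector cell (unions).  A cell contained in a union of sectors of one
-- column is contained in one of them: the cell lies in a sector m of that
-- column and is closed under translations and pointwise minima, and the minimum
-- of two points, translated so as to agree at m, avoids every sector avoided by
-- one of the two.

open import Defs
import Algebra.Construct.NaturalChoice.Min as Min
open import Algebra.Core using (Op₂)
import Algebra.Properties.Group as GroupProperties
open import Data.Bool.Base using (true; false)
open import Data.Empty.Irrelevant using (⊥-elim)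
open import Data.Fin.Base using (Fin; zero; suc)
open import Data.Fin.Properties using (any?; all?; ¬∀⟶∃¬)
open import Data.Fin.Subset as Subset using (Subset; ⊤; ⊥; ⁅_⁆; ∁)
open import Data.Fin.Subset.Properties as Subsetₚ using (_∈?_)
open import Data.Irrelevant using ([_])
open import Data.List.Base using (filter; allFin; tabulate)
import Data.List.Extrema as Extrema
open import Data.List.Membership.Propositional.Properties using (∈-allFin; ∈-filter⁺)
import Data.List.Relation.Unary.All as All
import Data.List.Relation.Unary.All.Properties as All
open import Data.Maybe.Base using (zipWith; fromMaybe; maybe′; is-nothing)
open import Data.Nat.Base using (ℕ)
open import Data.Product.Base using (∃; ∃-syntax; _×_; _,_; proj₁; proj₂)
open import Data.Refinement.Base using (value; _,_)
open import Data.Sign.Base as Sign using (Sign)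
open import Data.Sign.Properties using () renaming (_≟_ to _≟ₛ_)
open import Data.Sum.Base using (_⊎_; inj₁; inj₂; [_,_]′)
import Data.Vec.Base as Vec
open import Data.Vec.Functional using (Vector)
open import Data.Vec.Properties using (lookup∘tabulate; lookup⇒[]=; []=⇒lookup)
open import Function.Base using (id; _∘_)
open import Function.Bundles using (_⇔_; mk⇔)
open import Level using (0ℓ)
open import Relation.Binary.Bundles using (TotalOrder)
open import Relation.Binary.PropositionalEquality as ≡ using (_≡_; _≢_)
open import Relation.Binary.Structures using (IsDecTotalOrder)
open import Relation.Nullary using (¬_; Dec; yes; no; contradiction)
open import Relation.Nullary.Construct.Add.Supremum
  using () renaming ([_] to fin; ⊤⁺ to ∞)
open import Relation.Nullary.Decidable
  using (map′; ¬?; _×-dec_; _⊎-dec_; _→-dec_; decidable-stable)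
open import Relation.Unary
  using (Pred; _∈_; _∉_; _⊆_; _∩_; ⋃; ⋂; Satisfiable; Decidable)
import Relation.Binary.Construct.Add.Supremum.Equality as SupremumEquality
import Relation.Binary.Construct.Add.Supremum.NonStrict as SupremumOrder
import Relation.Binary.Reasoning.PartialOrder as PartialOrderReasoning

-- Sign vectors and signed graphs.

signed? : ∀ {d n} {Ψ : Graph d n} → Decidable Ψ → ∀ ε → Decidable (signed Ψ ε)
signed? Ψ? ε (i , j) =
  (Ψ? (i , j) ×-dec (ε j ≟ₛ Sign.+)) ⊎-dec (¬? (Ψ? (i , j)) ×-dec (ε j ≟ₛ Sign.-))

-- The sign at `j` is dictated by whether the single arc `(f j , j)` belongs to `Ψ`. This supplies
-- the sign vector in the covering argument.
∃-signed : ∀ {d n} {Ψ : Graph d n} → Decidable Ψ → (f : Fin n → Fin d) →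
           ∃[ ε ] (∀ j → (f j , j) ∈ signed Ψ ε)
∃-signed {Ψ = Ψ} Ψ? f = proj₁ ∘ choose , proj₂ ∘ choose
  where
  choose : ∀ j → ∃[ s ] (((f j , j) ∈ Ψ × s ≡ Sign.+) ⊎ ((f j , j) ∉ Ψ × s ≡ Sign.-))
  choose j with Ψ? (f j , j)
  ... | yes p = Sign.+ , inj₁ (p , ≡.refl)
  ... | no ¬p = Sign.- , inj₂ (¬p , ≡.refl)

module Sectors (ℝ : RealNumbers) where
  open RealNumbers ℝ renaming (Carrier to R) hiding (zero)
  open Tropical ℝ
  open IsDecTotalOrder isDecTotalOrder using (total; antisym; _≤?_)
    renaming (refl to ≤-refl; trans to ≤-trans; reflexive to ≤-reflexive;
              isTotalOrder to ≤-isTotalOrder)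
  open GroupProperties +-group using (\\-leftDividesʳ; //-rightDividesʳ)
  open SupremumEquality _≈_ hiding ([≈]-injective)
  open SupremumOrder _≤_

  -- Orders, and the classical logic that completeness provides.

  ≤-totalOrder : TotalOrder 0ℓ 0ℓ 0ℓ
  ≤-totalOrder = record { isTotalOrder = ≤-isTotalOrder }

  ≤⁺-totalOrder : TotalOrder 0ℓ 0ℓ 0ℓ
  ≤⁺-totalOrder = record { isTotalOrder = ≤⁺-isTotalOrder ≤-isTotalOrder }

  module ≤-Reasoning = PartialOrderReasoning (TotalOrder.poset ≤-totalOrder)
  module ≤⁺-Reasoning = PartialOrderReasoning (TotalOrder.poset ≤⁺-totalOrder)
  open Min ≤-totalOrder using (_⊓_; x⊓y≤x; x⊓y≤y; ⊓-glb; ⊓-sel)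

  -- Completeness and decidability of the order decide Q ⊎ ¬ Q up to double
  -- negation: the supremum of {lo} ∪ {hi | Q} exceeds lo iff Q is not refuted.
  weakExcludedMiddle-< : ∀ {lo hi} → lo ≤ hi → ¬ hi ≤ lo → (Q : Set) → Dec (¬ Q)
  weakExcludedMiddle-< {lo} {hi} lo≤hi hi≰lo Q = decide (complete P (lo , lo∈P) (hi , P≤hi))
    where
    data P : Pred R 0ℓ where
      lo∈P : P lo
      hi∈P : Q → P hi
    P≤hi : hi ∈ UpperBound P
    P≤hi lo∈P     = lo≤hi
    P≤hi (hi∈P _) = ≤-refl
    decide : ∃[ s ] s ∈ UpperBound P × (∀ {b} → b ∈ UpperBound P → s ≤ b) → Dec (¬ Q)
    decide (s , P≤s , least) with s ≤? lo
    ... | yes s≤lo = yes λ q → hi≰lo (≤-trans (P≤s (hi∈P q)) s≤lo)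
    ... | no  s≰lo = no λ ¬q → s≰lo (least λ { lo∈P → ≤-refl ; (hi∈P q) → contradiction q ¬q })

  weakExcludedMiddle : (Q : Set) → Dec (¬ Q)
  -- Any two distinct comparable elements serve, so either of `0#` and `1#` may be the smaller one.
  weakExcludedMiddle with total 0# 1#
  ... | inj₁ 0≤1 = weakExcludedMiddle-< 0≤1 λ 1≤0 → 0≉1 (antisym 0≤1 1≤0)
  ... | inj₂ 1≤0 = weakExcludedMiddle-< 1≤0 λ 0≤1 → 0≉1 (antisym 0≤1 1≤0)

  -- Inclusion in a decidable set is stable under double negation, so deciding its negation decides
  -- it.
  ⊆-dec : ∀ {X : Set} {D E : Pred X 0ℓ} → Decidable E → Dec (D ⊆ E)
  ⊆-dec {D = D} {E} E? with weakExcludedMiddle (D ⊆ E)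
  ... | yes D⊈E  = no D⊈E
  ... | no  ¬D⊈E = yes λ x∈D → decidable-stable (E? _) λ x∉E →
    ¬D⊈E λ D⊆E → x∉E (D⊆E x∈D)

  -- Sets closed under an operation and covered by finitely many faces.

  module _ {X : Set} {D : Pred X 0ℓ} (_∙_ : Op₂ X)
           (∙-closed : ∀ {x y} → x ∈ D → y ∈ D → x ∙ y ∈ D) where

    -- Modelled on faces of convex sets, with `x ∙ y` in the role of an interior point of a segment.
    IsFace : Pred X 0ℓ → Set
    IsFace F = ∀ {x y} → x ∈ D → y ∈ D → x ∙ y ∈ F → x ∈ F × y ∈ F

    -- By induction, some `x` avoids all later faces. If `y` avoids the first, then `x ∙ y` avoids
    -- all of them, since a face containing it would contain both `x` and `y`. The double negation
    -- is there because failure of an inclusion gives no explicit `y`.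
    commonAvoidance : ∀ {k} (F : Fin k → Pred X 0ℓ) → (∀ i → Decidable (F i)) →
                      (∀ i → IsFace (F i)) → Satisfiable D → (∀ i → ¬ D ⊆ F i) →
                      ¬ ¬ (∃[ x ] x ∈ D × (∀ i → x ∉ F i))
    commonAvoidance {0} F F? face (x , x∈D) D⊈F none = none (x , x∈D , λ ())
    commonAvoidance {ℕ.suc k} F F? face D≢∅ D⊈F none =
      commonAvoidance (F ∘ suc) (F? ∘ suc) (face ∘ suc) D≢∅ (D⊈F ∘ suc)
        λ (x , x∈D , x∉F) → D⊈F zero λ {y} y∈D →
          decidable-stable (F? zero y) λ y∉F →
            none (x ∙ y , ∙-closed x∈D y∈D , λ
              { zero    → y∉F ∘ proj₂ ∘ face zero x∈D y∈D
              ; (suc i) → x∉F i ∘ proj₁ ∘ face (suc i) x∈D y∈D })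

    -- If no `F i` contained `D`, a common avoiding point would contradict the cover. The conclusion
    -- is a finite search over decidable inclusions, so it may be proved by contradiction.
    coveredByFaces : ∀ {k} (F : Fin k → Pred X 0ℓ) → (∀ i → Decidable (F i)) →
                     (∀ i → IsFace (F i)) → Satisfiable D → D ⊆ ⋃ (Fin k) F →
                     ∃[ i ] D ⊆ F i
    coveredByFaces F F? face D≢∅ D⊆⋃F =
      decidable-stable (any? λ i → ⊆-dec (F? i)) λ none →
        commonAvoidance F F? face D≢∅ (λ i D⊆F → none (i , D⊆F))
          λ (x , x∈D , x∉F) → let (i , x∈F) = D⊆⋃F x∈D in x∉F i x∈F

  -- Differences of real and extended real numbers.

  telescope : ∀ x y z → (x - y) + (y - z) ≈ x - z
  telescope x y z = trans (+-assoc x (- y) (y - z)) (+-congˡ (\\-leftDividesʳ y (- z)))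

  +-monoˡ-≤ : ∀ z {x y} → x ≤ y → x + z ≤ y + z
  +-monoˡ-≤ z {x} {y} x≤y = begin
    x + z ≈⟨ +-comm x z ⟩
    z + x ≤⟨ +-monoʳ-≤ z x≤y ⟩
    z + y ≈⟨ +-comm z y ⟩
    y + z ∎
    where open ≤-Reasoning

  -- Exchanging `y` and `b` gives the converse, so this one lemma converts sector inequalities into
  -- comparisons of the differences `z ℓ - u ℓ`, and back.
  ≤-exchange : ∀ {x y b a} → x - y ≤ b - a → x - b ≤ y - a
  ≤-exchange {x} {y} {b} {a} h = begin
    x - b             ≈⟨ telescope x y b ⟨
    (x - y) + (y - b) ≤⟨ +-monoˡ-≤ (y - b) h ⟩
    (b - a) + (y - b) ≈⟨ +-comm (b - a) (y - b) ⟩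
    (y - b) + (b - a) ≈⟨ telescope y b a ⟩
    y - a             ∎
    where open ≤-Reasoning

  infixl 6 _⊟_

  -- Junk value: s ⊟ ∞ = ∞.
  _⊟_ : T → T → T
  _⊟_ = zipWith _-_

  ⊟-monoˡ-≤⁺ : ∀ {s t} b → s ≤⁺ t → s ⊟ b ≤⁺ t ⊟ b
  ⊟-monoˡ-≤⁺ ∞       (k ≤⊤⁺) = _ ≤⊤⁺
  ⊟-monoˡ-≤⁺ (fin b) (k ≤⊤⁺) = _ ≤⊤⁺
  ⊟-monoˡ-≤⁺ ∞       [ k≤l ] = _ ≤⊤⁺
  ⊟-monoˡ-≤⁺ (fin b) [ k≤l ] = [ +-monoˡ-≤ (- b) k≤l ]

  ⊞-monoʳ-≤⁺ : ∀ c {s t} → s ≤⁺ t → fin c ⊞ s ≤⁺ fin c ⊞ t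
  ⊞-monoʳ-≤⁺ c (k ≤⊤⁺) = _ ≤⊤⁺
  ⊞-monoʳ-≤⁺ c [ k≤l ] = [ +-monoʳ-≤ c k≤l ]

  ⊟-≈⁺-⊞ : ∀ {p q c} b → p ≈⁺ fin c ⊞ q → p ⊟ b ≈⁺ fin c ⊞ (q ⊟ b)
  ⊟-≈⁺-⊞ {∞}     {∞}     b       ⊤⁺≈⊤⁺   = ⊤⁺≈⊤⁺
  ⊟-≈⁺-⊞ {fin x} {fin y} ∞       _       = ⊤⁺≈⊤⁺
  ⊟-≈⁺-⊞ {fin x} {fin y} (fin b) [ x≈y ] = [ trans (+-congʳ x≈y) (+-assoc _ _ _) ]

  -- Supports and domination.

  _≟∞ : (t : T) → Dec (t ≡ ∞)
  ∞     ≟∞ = yes ≡.refl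
  fin _ ≟∞ = no λ ()

  supp? : ∀ {I : Set} (u : I → T) → Decidable (supp u)
  supp? u i = ¬? (u i ≟∞)

  fin≢∞ : ∀ {t : T} {a} → t ≡ fin a → t ≢ ∞
  fin≢∞ ≡.refl ()

  ≢∞⇒fin : ∀ {t : T} → t ≢ ∞ → ∃[ a ] t ≡ fin a
  ≢∞⇒fin {∞}     t≢∞ = contradiction ≡.refl t≢∞
  ≢∞⇒fin {fin a} _   = a , ≡.refl

  -- Unlike `Sector`, this makes sense at points with infinite coordinates. Only indices in the
  -- support are compared, so the junk value of `⊟` never enters. The difference `p ℓ ⊟ u ℓ` is
  -- called the excess at `ℓ`.
  record Dominates {I : Set} (u p : I → T) (i : I) : Set where
    constructor _,_
    field
      inSupp  : i ∈ supp u
      maximal : ∀ ℓ → ℓ ∈ supp u → p ℓ ⊟ u ℓ ≤⁺ p i ⊟ u i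
  open Dominates using (inSupp)

  dominates? : ∀ {d} (u p : Vector T d) → Decidable (Dominates u p)
  dominates? u p i = map′ (λ (i∈ , p≤) → i∈ , p≤) (λ (i∈ , p≤) → i∈ , p≤)
    (supp? u i ×-dec all? λ ℓ → supp? u ℓ →-dec ≤⁺-dec _≤?_ (p ℓ ⊟ u ℓ) (p i ⊟ u i))

  ∃-dominates : ∀ {d} (u p : Vector T d) → ¬ AllInfinite u → ∃ (Dominates u p)
  ∃-dominates {d} u p u≢∞ =
    -- The default index of `argmax` must itself lie in the support, since it may be the one
    -- returned.
    let (i₀ , i₀∈) = ¬∀⟶∃¬ d _ (λ i → u i ≟∞) u≢∞
        support    = filter (supp? u) (allFin d)
        excess     = λ ℓ → p ℓ ⊟ u ℓ
    in argmax excess i₀ support ,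
       argmax-all excess i₀∈ (All.all-filter (supp? u) (allFin d)) ,
       λ ℓ ℓ∈ → All.lookup (f[xs]≤f[argmax] {f = excess} i₀ support)
                           (∈-filter⁺ (supp? u) (∈-allFin ℓ) ℓ∈)
    where open Extrema ≤⁺-totalOrder

  module _ {I : Set} {u : I → T} where

    dominates-translate : ∀ {p q : I → T} {i} c → (∀ ℓ → p ℓ ≈⁺ fin c ⊞ q ℓ) →
                          Dominates u q i → Dominates u p i
    dominates-translate {p} {q} {i} c p≈c+q (i∈ , q≤) = i∈ , λ ℓ ℓ∈ → begin
      p ℓ ⊟ u ℓ             ≈⟨ ⊟-≈⁺-⊞ (u ℓ) (p≈c+q ℓ) ⟩
      fin c ⊞ (q ℓ ⊟ u ℓ)   ≤⟨ ⊞-monoʳ-≤⁺ c (q≤ ℓ ℓ∈) ⟩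
      fin c ⊞ (q i ⊟ u i)   ≈⟨ ⊟-≈⁺-⊞ (u i) (p≈c+q i) ⟨
      p i ⊟ u i             ∎
      where open ≤⁺-Reasoning

    -- Passing from `p` to `r` raises no excess and keeps the one at `i`.
    dominates-lower : ∀ {p r : I → T} {i} → (∀ ℓ → r ℓ ≤⁺ p ℓ) → p i ≤⁺ r i →
                      Dominates u p i → Dominates u r i
    dominates-lower {p} {r} {i} r≤p pᵢ≤rᵢ (i∈ , p≤) = i∈ , λ ℓ ℓ∈ → begin
      r ℓ ⊟ u ℓ ≤⟨ ⊟-monoˡ-≤⁺ (u ℓ) (r≤p ℓ) ⟩
      p ℓ ⊟ u ℓ ≤⟨ p≤ ℓ ℓ∈ ⟩
      p i ⊟ u i ≤⟨ ⊟-monoˡ-≤⁺ (u i) pᵢ≤rᵢ ⟩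
      r i ⊟ u i ∎
      where open ≤⁺-Reasoning

    -- The largest excess of `p` is at `m`, where `p` and `r` agree, so it is at most the largest
    -- excess of `r`. That one is at `i`, where `p` is at least `r`.
    dominates-raise : ∀ {p r : I → T} {i m} → (∀ ℓ → r ℓ ≤⁺ p ℓ) → p m ≤⁺ r m →
                      Dominates u p m → Dominates u r i → Dominates u p i
    dominates-raise {p} {r} {i} {m} r≤p pₘ≤rₘ (m∈ , p≤) (i∈ , r≤) = i∈ , λ ℓ ℓ∈ → begin
      p ℓ ⊟ u ℓ ≤⟨ p≤ ℓ ℓ∈ ⟩
      p m ⊟ u m ≤⟨ ⊟-monoˡ-≤⁺ (u m) pₘ≤rₘ ⟩
      r m ⊟ u m ≤⟨ r≤ m m∈ ⟩
      r i ⊟ u i ≤⟨ ⊟-monoˡ-≤⁺ (u i) (r≤p i) ⟩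
      p i ⊟ u i ∎
      where open ≤⁺-Reasoning

    sector⇒dominates : ∀ {z i} → z ∈ Sector u i → Dominates u (fin ∘ z) i
    sector⇒dominates {z} {i} (a , uᵢ≡a , z≤) = fin≢∞ uᵢ≡a , λ ℓ ℓ∈ →
      let (b , uℓ≡b) = ≢∞⇒fin ℓ∈ in
      ≡.subst₂ (λ s t → fin (z ℓ) ⊟ s ≤⁺ fin (z i) ⊟ t) (≡.sym uℓ≡b) (≡.sym uᵢ≡a)
        [ ≤-exchange (z≤ ℓ b uℓ≡b) ]

    dominates⇒sector : ∀ {z i} → Dominates u (fin ∘ z) i → z ∈ Sector u i
    dominates⇒sector {z} {i} (i∈ , z≤) =
      let (a , uᵢ≡a) = ≢∞⇒fin i∈ in a , uᵢ≡a , λ ℓ b uℓ≡b →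
      ≤-exchange ([≤]-injective
        (≡.subst₂ (λ s t → fin (z ℓ) ⊟ s ≤⁺ fin (z i) ⊟ t) uℓ≡b uᵢ≡a
          (z≤ ℓ (fin≢∞ uℓ≡b))))

  -- Sectors and tropical sums.

  meet : ∀ {I : Set} → I → Op₂ (I → R)
  -- A tropical linear combination, with coefficients chosen so that both terms have the same value
  -- at `m`.
  meet m w v ℓ = (v m + w ℓ) ⊓ (w m + v ℓ)

  module _ {I : Set} {u : I → T} (m : I) {w v : I → R} where

    private
      meet≤w : ∀ ℓ → fin (meet m w v ℓ) ≤⁺ fin (v m + w ℓ)
      meet≤w ℓ = [ x⊓y≤x _ _ ]

      meet≤v : ∀ ℓ → fin (meet m w v ℓ) ≤⁺ fin (w m + v ℓ)
      meet≤v ℓ = [ x⊓y≤y _ _ ]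

      untranslate : ∀ c {x : I → R} {i} → Dominates u (λ ℓ → fin (c + x ℓ)) i →
                    Dominates u (fin ∘ x) i
      untranslate c {x} =
        dominates-translate (- c) λ ℓ → [ sym (\\-leftDividesʳ c (x ℓ)) ]

      translate : ∀ c {x : I → R} {i} → Dominates u (fin ∘ x) i →
                  Dominates u (λ ℓ → fin (c + x ℓ)) i
      translate c = dominates-translate c λ ℓ → [ refl ]

    -- At `i` the minimum equals one of the two translates. It lies below that translate everywhere,
    -- so `i` still dominates.
    sector-meet : ∀ {i} → w ∈ Sector u i → v ∈ Sector u i → meet m w v ∈ Sector u i
    sector-meet {i} w∈ v∈ with ⊓-sel (v m + w i) (w m + v i)
    ... | inj₁ meet≈w = dominates⇒sector
      (dominates-lower meet≤w [ ≤-reflexive (sym meet≈w) ]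
        (translate (v m) (sector⇒dominates w∈)))
    ... | inj₂ meet≈v = dominates⇒sector
      (dominates-lower meet≤v [ ≤-reflexive (sym meet≈v) ]
        (translate (w m) (sector⇒dominates v∈)))

    -- The minimum lies below both translates and agrees with both at `m`, which dominates each of
    -- them, so `dominates-raise` applies to each.
    sector-face : ∀ {i} → w ∈ Sector u m → v ∈ Sector u m →
                  meet m w v ∈ Sector u i → w ∈ Sector u i × v ∈ Sector u i
    sector-face w∈ v∈ meet∈ =
      dominates⇒sector (untranslate (v m)
        (dominates-raise meet≤w [ ⊓-glb ≤-refl (≤-reflexive (+-comm _ _)) ]
          (translate (v m) (sector⇒dominates w∈)) (sector⇒dominates meet∈))) ,
      dominates⇒sector (untranslate (w m)
        (dominates-raise meet≤v [ ⊓-glb (≤-reflexive (+-comm _ _)) ≤-refl ]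
          (translate (w m) (sector⇒dominates v∈)) (sector⇒dominates meet∈)))

  -- Closed sectors described by domination.

  ≋⇒∼ : ∀ {d} {p q : Vector T d} → p ≋ q → p ∼ q
  ≋⇒∼ {p = p} {q} p≋q = 0# , λ i → shift (p≋q i)
    where
    shift : ∀ {s t} → s ≈⁺ t → s ≈⁺ fin 0# ⊞ t
    shift ⊤⁺≈⊤⁺   = ⊤⁺≈⊤⁺
    shift [ s≈t ] = [ trans s≈t (sym (+-identityˡ _)) ]

  dominates-∼ : ∀ {d} {u p q : Vector T d} {i} → p ∼ q → Dominates u q i → Dominates u p i
  dominates-∼ (c , p≈c+q) = dominates-translate c p≈c+q

  dominates-≋ : ∀ {d} {u p q : Vector T d} {i} → p ≋ q → Dominates u q i → Dominates u p i
  dominates-≋ {q = q} p≋q = dominates-∼ {q = q} (≋⇒∼ p≋q)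

  infinite : ∀ {d} → Vector T d → Subset d
  infinite p = Vec.tabulate (is-nothing ∘ p)

  ∈-infinite⁺ : ∀ {d} (p : Vector T d) {i} → p i ≡ ∞ → i Subset.∈ infinite p
  ∈-infinite⁺ p {i} pᵢ≡∞ = lookup⇒[]= i _
    (≡.trans (lookup∘tabulate (is-nothing ∘ p) i) (≡.cong is-nothing pᵢ≡∞))

  ∈-infinite⁻ : ∀ {d} (p : Vector T d) {i} → i Subset.∈ infinite p → p i ≡ ∞
  ∈-infinite⁻ p {i} i∈ = nothing
    (≡.trans (≡.sym (lookup∘tabulate (is-nothing ∘ p) i)) ([]=⇒lookup i∈))
    where
    nothing : ∀ {t : T} → is-nothing t ≡ true → t ≡ ∞
    nothing {∞} _ = ≡.refl

  ≤⁺∞⊟ : ∀ {s t} b → t ≡ ∞ → s ≤⁺ t ⊟ b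
  ≤⁺∞⊟ b ≡.refl = _ ≤⊤⁺

  -- The excess at `ℓ` is infinite, hence so is the maximal one at `i`. As `u i` is finite, `p i`
  -- must be infinite.
  dominates-∞ : ∀ {I : Set} {u p : I → T} {i ℓ} → Dominates u p i →
                ℓ ∈ supp u → p ℓ ≡ ∞ → p i ≡ ∞
  dominates-∞ {u = u} {p} {i} {ℓ} (i∈ , p≤) ℓ∈ pℓ≡∞ = propagate {u ℓ} {p i} i∈
    (≡.subst (λ t → t ⊟ u ℓ ≤⁺ p i ⊟ u i) pℓ≡∞ (p≤ ℓ ℓ∈))
    where
    propagate : ∀ {s t b} → b ≢ ∞ → ∞ ⊟ s ≤⁺ t ⊟ b → t ≡ ∞
    propagate {t = ∞} _ _ = ≡.refl
    propagate {t = fin _} {∞}     b≢∞ _ = contradiction ≡.refl b≢∞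
    propagate {t = fin _} {fin _} b≢∞ ()

  ∞⇒dominates : ∀ {I : Set} {u p : I → T} {i} → i ∈ supp u → p i ≡ ∞ → Dominates u p i
  ∞⇒dominates {u = u} {i = i} i∈ pᵢ≡∞ = i∈ , λ _ _ → ≤⁺∞⊟ (u i) pᵢ≡∞

  boundary-∈ : ∀ {d} {K : Subset d} {i} → i Subset.∈ K → boundary K i ≡ ∞
  boundary-∈ i∈K rewrite []=⇒lookup i∈K = ≡.refl

  boundary-∉ : ∀ {d} {K : Subset d} {i} → i Subset.∉ K → boundary K i ≡ fin 0#
  boundary-∉ {K = K} {i} i∉K with Vec.lookup K i in eq
  ... | true               = contradiction (lookup⇒[]= i K eq) i∉K
  ... | false               = ≡.refl

  -- Either `K` contains `i`, and the infinite excess there is maximal, or `K` misses the support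
  -- and the comparisons are those for `z`.
  boundary-dominates : ∀ {d} {u : Vector T d} {i K} {z : Vector R d} → K ∈ 𝒦 u i →
                       z ∈ Sector u i →
                       Dominates u (λ ℓ → boundary K ℓ ⊞ fin (z ℓ)) i
  boundary-dominates {u = u} {i} {z = z} (A , B , inj₂ (M , _ , ≡.refl) , _ , ≡.refl) z∈ =
    ∞⇒dominates (inSupp (sector⇒dominates z∈))
      (≡.cong (_⊞ fin (z i)) (boundary-∈ i∈K))
    where
    i∈K : i Subset.∈ (M Subset.∪ ⁅ i ⁆) Subset.∪ B
    i∈K = Subsetₚ.x∈p∪q⁺ (inj₁ (Subsetₚ.x∈p∪q⁺ {p = M} (inj₂ (Subsetₚ.x∈⁅x⁆ i))))
  boundary-dominates {u = u} {i} {K} {z} (A , B , inj₁ ≡.refl , B∈ℬ , ≡.refl) z∈ =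
    -- On the support `boundary K` is `fin 0#`, so adding it there is translation by `0#`.
    let (i∈ , z≤) = dominates-translate 0# (λ _ → ≈⁺-refl refl) (sector⇒dominates z∈)
    in i∈ , λ ℓ ℓ∈ →
      ≡.subst₂ (λ s t → (s ⊞ fin (z ℓ)) ⊟ u ℓ ≤⁺ (t ⊞ fin (z i)) ⊟ u i)
        (≡.sym (boundary-supp ℓ∈)) (≡.sym (boundary-supp i∈)) (z≤ ℓ ℓ∈)
    where
    boundary-supp : ∀ {ℓ} → ℓ ∈ supp u → boundary K ℓ ≡ fin 0#
    boundary-supp ℓ∈ = boundary-∉ {K = K} λ ℓ∈K →
      [ Subsetₚ.∉⊥ , (λ ℓ∈B → B∈ℬ ℓ∈B ℓ∈) ]′ (Subsetₚ.x∈p∪q⁻ ⊥ B ℓ∈K)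

  closedSector⇒dominates : ∀ {d} {u : Vector T d} {i} (p : TP d) →
                           p ∈ ClosedSector u i → Dominates u (proj₁ p) i
  closedSector⇒dominates _ (x , inj₁ (z , z∈ , x≋z) , p∼x) =
    dominates-∼ {q = x} p∼x (dominates-≋ x≋z (sector⇒dominates z∈))
  closedSector⇒dominates _ (x , inj₂ ((K , K∈) , z , z∈ , x≋z) , p∼x) =
    dominates-∼ {q = x} p∼x (dominates-≋ x≋z (boundary-dominates K∈ z∈))

  upperBound : ∀ {d} (f : Vector R d) → ∃[ B ] (∀ i → f i ≤ B)
  upperBound f = max 0# (tabulate f) , All.tabulate⁻ (xs≤max 0# (tabulate f))
    where open Extrema ≤-totalOrder

  module _ {d} {u p : Vector T d} {i : Fin d} where

    -- If `p i` is finite, domination keeps the infinite coordinates off the support, so they form a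
    -- member of `ℬ`. Otherwise they are split along the support, and `i` joins the part in `𝒜`.
    infinite∈𝒦 : Dominates u p i → infinite p ∈ 𝒦 u i
    infinite∈𝒦 dom@(i∈ , _) with p i ≟∞
    ... | no pᵢ≢∞ = ⊥ , infinite p , inj₁ ≡.refl ,
      (λ ℓ∈K ℓ∈ → pᵢ≢∞ (dominates-∞ {u = u} {p} dom ℓ∈ (∈-infinite⁻ p ℓ∈K))) ,
      ≡.sym (Subsetₚ.∪-identityˡ (infinite p))
    ... | yes pᵢ≡∞ = A , B , inj₂ (K Subset.∩ ∁ N , M⊆supp , ≡.refl) , B∈ℬ ,
      Subsetₚ.⊆-antisym K⊆A∪B A∪B⊆K
      where
      K N A B : Subset d
      K = infinite p
      N = infinite u
      A = (K Subset.∩ ∁ N) Subset.∪ ⁅ i ⁆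
      B = K Subset.∩ N
      M⊆supp : ∀ {ℓ} → ℓ Subset.∈ K Subset.∩ ∁ N → ℓ ∈ supp u
      M⊆supp ℓ∈M uℓ≡∞ =
        Subsetₚ.x∈∁p⇒x∉p (proj₂ (Subsetₚ.x∈p∩q⁻ K (∁ N) ℓ∈M)) (∈-infinite⁺ u uℓ≡∞)
      B∈ℬ : B ∈ ℬ u
      B∈ℬ ℓ∈B ℓ∈ = ℓ∈ (∈-infinite⁻ u (proj₂ (Subsetₚ.x∈p∩q⁻ K N ℓ∈B)))
      K⊆A∪B : K Subset.⊆ A Subset.∪ B
      K⊆A∪B {ℓ} ℓ∈K with ℓ ∈? N
      ... | yes ℓ∈N = Subsetₚ.x∈p∪q⁺ {p = A} (inj₂ (Subsetₚ.x∈p∩q⁺ (ℓ∈K , ℓ∈N)))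
      ... | no  ℓ∉N = Subsetₚ.x∈p∪q⁺ (inj₁ (Subsetₚ.x∈p∪q⁺
        (inj₁ (Subsetₚ.x∈p∩q⁺ (ℓ∈K , Subsetₚ.x∉p⇒x∈∁p ℓ∉N)))))
      A∪B⊆K : A Subset.∪ B Subset.⊆ K
      A∪B⊆K ℓ∈A∪B with Subsetₚ.x∈p∪q⁻ A B ℓ∈A∪B
      ... | inj₂ ℓ∈B = proj₁ (Subsetₚ.x∈p∩q⁻ K N ℓ∈B)
      ... | inj₁ ℓ∈A with Subsetₚ.x∈p∪q⁻ (K Subset.∩ ∁ N) ⁅ i ⁆ ℓ∈A
      ...   | inj₁ ℓ∈M = proj₁ (Subsetₚ.x∈p∩q⁻ K (∁ N) ℓ∈M)
      ...   | inj₂ ℓ∈i = ∈-infinite⁺ p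
        (≡.trans (≡.cong p (Subsetₚ.x∈⁅y⁆⇒x≡y i ℓ∈i)) pᵢ≡∞)

    -- Where p is infinite, lift it far enough above u to stay in the sector.
    private
      B : R
      B = proj₁ (upperBound λ ℓ → fromMaybe 0# (p ℓ) - fromMaybe 0# (u ℓ))

      lift : T → T → R
      lift s b = maybe′ id (B + fromMaybe 0# b) s

      lift-∞ : ∀ b → (B + b) - b ≤ B
      lift-∞ b = ≤-reflexive (//-rightDividesʳ b B)

    -- On the support, a lifted coordinate has excess exactly `B`, and `B` bounds the finite
    -- excesses. If any coordinate in the support is lifted, then so is the one at `i`, by
    -- domination.
    lift∈Sector : Dominates u p i → (λ ℓ → lift (p ℓ) (u ℓ)) ∈ Sector u i
    lift∈Sector dom@(i∈ , p≤) = dominates⇒sector (i∈ , λ ℓ ℓ∈ →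
        bound (proj₂ (upperBound _) ℓ) ℓ∈ i∈ (p≤ ℓ ℓ∈))
      where
      bound : ∀ {s t b a} → fromMaybe 0# s - fromMaybe 0# b ≤ B → b ≢ ∞ → a ≢ ∞ →
              s ⊟ b ≤⁺ t ⊟ a → fin (lift s b) ⊟ b ≤⁺ fin (lift t a) ⊟ a
      bound {b = ∞} s≤B b≢∞ a≢∞ h = contradiction ≡.refl b≢∞
      bound {b = fin b} {∞} s≤B b≢∞ a≢∞ h = contradiction ≡.refl a≢∞
      bound {fin s} {fin t} {fin b} {fin a} s≤B b≢∞ a≢∞ h = h
      bound {fin s} {∞} {fin b} {fin a} s≤B b≢∞ a≢∞ h =
        [ ≤-trans s≤B (≤-reflexive (sym (//-rightDividesʳ a B))) ]
      bound {∞} {∞} {fin b} {fin a} s≤B b≢∞ a≢∞ h =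
        [ ≤-trans (lift-∞ b) (≤-reflexive (sym (//-rightDividesʳ a B))) ]

    dominates⇒closedSector : ∀ p≢∞ → Dominates u p i → (p , p≢∞) ∈ ClosedSector u i
    dominates⇒closedSector _ dom =
      -- The set of infinite coordinates serves as `K` for every point; for a finite point it is
      -- empty.
      _ , inj₂ ((infinite p , infinite∈𝒦 dom) , _ , lift∈Sector dom , λ _ → ≈⁺-refl refl) ,
      ≋⇒∼ p≋
      where
      p≋ : p ≋ (λ ℓ → boundary (infinite p) ℓ ⊞ fin (lift (p ℓ) (u ℓ)))
      p≋ ℓ rewrite lookup∘tabulate (is-nothing ∘ p) ℓ with p ℓ
      ... | ∞     = ⊤⁺≈⊤⁺
      ... | fin y = [ sym (+-identityˡ y) ]

  -- Points of a stratum.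

  module _ {d} {Z : Subset d} (w : Row Z → R) where

    extend-∈ : ∀ {i} → i Subset.∈ Z → extend Z w i ≡ ∞
    extend-∈ {i} i∈Z with i ∈? Z
    ... | yes _   = ≡.refl
    ... | no  i∉Z = contradiction i∈Z i∉Z

    extend-row : (r : Row Z) → extend Z w (value r) ≡ fin (w r)
    extend-row (i , [ i∉Z ]) with i ∈? Z
    ... | yes i∈Z = ⊥-elim (i∉Z i∈Z)
    ... | no  _   = ≡.refl

    extend-∞⁻ : ∀ {i} → extend Z w i ≡ ∞ → i Subset.∈ Z
    extend-∞⁻ {i} eq with i ∈? Z
    ... | yes i∈Z = i∈Z
    extend-∞⁻ {i} () | no _

    extend-≢∞ : Z Subset.⊂ ⊤ → ¬ AllInfinite (extend Z w)
    extend-≢∞ (_ , i , _ , i∉Z) all∞ = i∉Z (extend-∞⁻ (all∞ i))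

  -- Cells of a stratum and the columns of the full matrix.

  module _ {d n} (V : Matrix (Fin d) (Fin n)) where

    Removed : Subset d → Pred (Fin n) 0ℓ
    Removed Z j = ∃[ i ] i Subset.∈ Z × V i j ≢ ∞

    removed? : ∀ Z → Decidable (Removed Z)
    removed? Z j = any? λ i → (i ∈? Z) ×-dec supp? (column V j) i

    module _ {Z : Subset d} where

      column-∉ : (j : Column V Z) → ∀ {i} → V i (value j) ≢ ∞ → i Subset.∉ Z
      column-∉ (j , [ kept ]) {i} i∈ i∈Z = ⊥-elim (kept (i , i∈Z , i∈))

      -- The support of a kept column avoids `Z`, so deleting the rows in `Z` loses no comparison.
      sector⇒dominates-extend : ∀ (j : Column V Z) {r w} → w ∈ Sector (column (V ⟨ Z ⟩) j) r →
                                Dominates (column V (value j)) (extend Z w) (value r)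
      sector⇒dominates-extend j {r} {w} w∈ =
        let (r∈ , w≤) = sector⇒dominates w∈ in r∈ , λ ℓ ℓ∈ →
        let s = ℓ , [ column-∉ j ℓ∈ ] in
        ≡.subst₂ (λ x y → x ⊟ V ℓ (value j) ≤⁺ y ⊟ V (value r) (value j))
          (≡.sym (extend-row w s)) (≡.sym (extend-row w r)) (w≤ s ℓ∈)

      dominates-extend⇒sector : ∀ (j : Column V Z) {r w} →
                                Dominates (column V (value j)) (extend Z w) (value r) →
                                w ∈ Sector (column (V ⟨ Z ⟩) j) r
      dominates-extend⇒sector j {r} {w} (r∈ , w≤) = dominates⇒sector (r∈ , λ s s∈ →
        ≡.subst₂ (λ x y → x ⊟ V (value s) (value j) ≤⁺ y ⊟ V (value r) (value j))
          (extend-row w s) (extend-row w r) (w≤ (value s) s∈))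

      -- Some support row of a removed column lies in `Z`, where the point is infinite. Together
      -- with `dominates-removed⁺`, the dominating rows are the support rows in `Z`, the same
      -- throughout the stratum.
      dominates-removed⁻ : ∀ {j i w} → Removed Z j →
                           Dominates (column V j) (extend Z w) i → i Subset.∈ Z
      dominates-removed⁻ {w = w} (ℓ , ℓ∈Z , ℓ∈) dom =
        extend-∞⁻ w (dominates-∞ dom ℓ∈ (extend-∈ w ℓ∈Z))

      dominates-removed⁺ : ∀ {j i w} → V i j ≢ ∞ → i Subset.∈ Z →
                           Dominates (column V j) (extend Z w) i
      dominates-removed⁺ {w = w} i∈ i∈Z = ∞⇒dominates i∈ (extend-∈ w i∈Z)

      stratum⊆closedSector : ∀ {D : Pred (Row Z → R) 0ℓ} {u i} →
                             (∀ {w} → w ∈ D → Dominates u (extend Z w) i) →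
                             ∀ p → p ∈ image (extend Z) D /ℝ𝟏 → p ∈ ClosedSector u i
      stratum⊆closedSector dom (_ , p≢∞) (x , (w , w∈D , x≋) , p∼x) =
        dominates⇒closedSector p≢∞ (dominates-∼ {q = x} p∼x (dominates-≋ x≋ (dom w∈D)))

      refinementCell-meet : ∀ {D} → D ∈ RefinementCell (V ⟨ Z ⟩) → ∀ m {w v} →
                            w ∈ D → v ∈ D → meet m w v ∈ D
      refinementCell-meet (_ , E , E-cell , D⊆ , ⊆D) m {w} {v} w∈D v∈D = ⊆D λ j →
        let (_ , _ , _ , E⊆ , ⊆E) = E-cell j in
        ⊆E λ k → sector-meet m (E⊆ (D⊆ w∈D j) k) (E⊆ (D⊆ v∈D j) k)

      -- In a removed column the dominating rows are constant on the stratum, so one point of the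
      -- cell decides. In a kept column the cell lies in some sector `m`, relative to which the
      -- sectors are faces for `meet m`.
      refinementCell-covered :
        ∀ {D} → D ∈ RefinementCell (V ⟨ Z ⟩) → ∀ {Φ : Pred (Fin d) 0ℓ} → Decidable Φ → ∀ j →
        (∀ {w} → w ∈ D → ∃[ i ] i ∈ Φ × Dominates (column V j) (extend Z w) i) →
        ∃[ i ] i ∈ Φ × (∀ {w} → w ∈ D → Dominates (column V j) (extend Z w) i)
      refinementCell-covered {D} D-cell@((w₀ , w₀∈D) , E , E-cell , D⊆ , ⊆D) {Φ} Φ? j covered
        with removed? Z j
      ... | yes removed =
        let (i , i∈Φ , dom) = covered w₀∈D
        in i , i∈Φ , λ _ → dominates-removed⁺ (inSupp dom) (dominates-removed⁻ removed dom)
      ... | no kept =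
        let (i , D⊆F) = coveredByFaces (meet m) (refinementCell-meet D-cell m) F
                          (λ i w → Φ? i ×-dec dominates? _ _ i) face (w₀ , w₀∈D) covered
        in i , proj₁ (D⊆F w₀∈D) , proj₂ ∘ D⊆F
        where
        J : Column V Z
        J = j , [ kept ]
        -- Building `i ∈ Φ` into the face lets the family be indexed by all rows.
        F : Fin d → Pred (Row Z → R) 0ℓ
        F i w = i ∈ Φ × Dominates (column V j) (extend Z w) i
        m : Row Z
        m = proj₁ (proj₁ (proj₂ (E-cell J)))
        D⊆m : ∀ {w} → w ∈ D → w ∈ Sector (column (V ⟨ Z ⟩) J) m
        D⊆m w∈D = let (_ , m∈M , _ , E⊆ , _) = E-cell J in E⊆ (D⊆ w∈D J) m∈M
        face : ∀ i {w v} → w ∈ D → v ∈ D → meet m w v ∈ F i → w ∈ F i × v ∈ F i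
        face i w∈D v∈D (i∈Φ , dom) =
          let r         = i , [ column-∉ J (inSupp dom) ]
              (w∈ , v∈) = sector-face m {i = r} (D⊆m w∈D) (D⊆m v∈D)
                            (dominates-extend⇒sector J dom)
          in (i∈Φ , sector⇒dominates-extend J w∈) , (i∈Φ , sector⇒dominates-extend J v∈)

    module _ (V≢∞ : ∀ j → ¬ AllInfinite (column V j)) where

      -- The covector cell through a point.

      module _ (p : TP d) where

        private
          x : Vector T d
          x = proj₁ p

          Z : Subset d
          Z = infinite x

          w : Row Z → R
          w r = fromMaybe 0# (x (value r))

          x≋ : x ≋ extend Z w
          x≋ i with i ∈? Z
          ... | yes i∈Z rewrite ∈-infinite⁻ x i∈Z = ⊤⁺≈⊤⁺
          ... | no  i∉Z with x i in eq
          ...   | ∞     = contradiction (∈-infinite⁺ x eq) i∉Z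
          ...   | fin _ = [ refl ]

          -- The smallest cell of the column's complex that contains `w`.
          E : Column V Z → Pred (Row Z → R) 0ℓ
          E j = ⋂ (∃[ r ] w ∈ Sector (column (V ⟨ Z ⟩) j) r)
                  λ (r , _) → Sector (column (V ⟨ Z ⟩) j) r

          dominates-w : ∀ {u i} → Dominates u x i → Dominates u (extend Z w) i
          dominates-w = dominates-≋ λ i → ≈⁺-sym sym (x≋ i)

        cellAt : Pred (TP d) 0ℓ
        cellAt = image (extend Z) (⋂ (Column V Z) E) /ℝ𝟏

        cellAt-isCell : cellAt ∈ CovectorCell V
        cellAt-isCell =
          Z , (Subsetₚ.⊆⊤ , let (i , xᵢ≢∞) = ¬∀⟶∃¬ d _ (λ i → x i ≟∞) (proj₂ p)
                            in i , Subsetₚ.∈⊤ , xᵢ≢∞ ∘ ∈-infinite⁻ x) ,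
          ⋂ (Column V Z) E ,
          ((w , λ _ → proj₂) , E , E-cell , id , id) ,
          id , id
          where
          E-cell : ∀ j → E j ∈ SectorCell (column (V ⟨ Z ⟩) j)
          E-cell j =
            let (i , dom) = ∃-dominates (column V (value j)) x (V≢∞ (value j))
                r         = i , [ column-∉ j (inSupp dom) ]
            in (λ s → w ∈ Sector (column (V ⟨ Z ⟩) j) s) ,
               (r , dominates-extend⇒sector j {r} {w} (dominates-w dom)) ,
               (λ (_ , vᵣ≡a , _) → fin≢∞ vᵣ≡a) , id , id

        ∈-cellAt : p ∈ cellAt
        ∈-cellAt = x , (w , (λ _ → proj₂) , x≋) , ≋⇒∼ λ _ → ≈⁺-refl refl

        -- In a removed column, domination does not vary over the stratum. In a kept column, `E` is
        -- by construction inside every sector that contains `w`.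
        cellAt⊆closedSector : ∀ {j i} → p ∈ ClosedSector (column V j) i →
                              cellAt ⊆ ClosedSector (column V j) i
        cellAt⊆closedSector {j} {i} p∈ {q} with removed? Z j
        ... | yes removed = stratum⊆closedSector onD q
          where
          onD : ∀ {w′} → w′ ∈ ⋂ (Column V Z) E → Dominates (column V j) (extend Z w′) i
          onD _ =
            let dom = dominates-w (closedSector⇒dominates p p∈)
            in dominates-removed⁺ (inSupp dom) (dominates-removed⁻ removed dom)
        ... | no kept = stratum⊆closedSector onD q
          where
          onD : ∀ {w′} → w′ ∈ ⋂ (Column V Z) E → Dominates (column V j) (extend Z w′) i
          onD w∈ =
            let J   = j , [ kept ]
                dom = dominates-w (closedSector⇒dominates p p∈)
                r   = i , [ column-∉ J (inSupp dom) ]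
            in sector⇒dominates-extend J (w∈ J (r , dominates-extend⇒sector J {r} {w} dom))

        cellAt⊆thalf : ∀ Φ → p ∈ thalf V Φ → cellAt ⊆ thalf V Φ
        cellAt⊆thalf Φ p∈ {q} q∈ j =
          let ((i , i∈Φ) , p∈S) = p∈ j in (i , i∈Φ) , cellAt⊆closedSector p∈S {q} q∈

      -- Signed cells as unions of covector cells, and containment of cells.

      saturated⇒isUnionOf : ∀ {S : Pred (TP d) 0ℓ} → (∀ {p} → p ∈ S → cellAt p ⊆ S) →
                            IsUnionOf (CovectorCell V) S
      saturated⇒isUnionOf {S} sat =
        -- The points of `S` index the family: each lies in its own cell, and saturation keeps that
        -- cell inside `S`.
        ∃ S , (λ (p , _) → cellAt p) , (λ (p , _) → cellAt-isCell p) ,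
        (λ {p} p∈S → (p , p∈S) , ∈-cellAt p) , λ ((_ , p∈S) , q∈) → sat p∈S q∈

      signedCell-saturated : ∀ {Ψ S p} → S ∈ SignedCell V Ψ → p ∈ S → cellAt p ⊆ S
      signedCell-saturated {Ψ} {p = p} (_ , ε , S⊆ , ⊆S) p∈S {q} q∈ =
        ⊆S (cellAt⊆thalf p (signed Ψ ε) (S⊆ p∈S) {q} q∈)

      signedCells-generate : ∀ {Ψ} → Decidable Ψ →
                             GeneratesDecomposition (SignedCell V Ψ) (CovectorCell V)
      signedCells-generate {Ψ} Ψ? = record
        { covers = λ p →
            -- Every column has a dominating row at `p`; the signs are then chosen so that all these
            -- arcs belong to the signed graph.
            let dom      = λ j → ∃-dominates (column V j) (proj₁ p) (V≢∞ j)
                (ε , ε∈) = ∃-signed Ψ? (proj₁ ∘ dom)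
                p∈       = λ j → (proj₁ (dom j) , ε∈ j) ,
                                 dominates⇒closedSector (proj₂ p) (proj₂ (dom j))
            in thalf V (signed Ψ ε) , ((p , p∈) , ε , id , id) , p∈
        ; unions = λ S∈ → saturated⇒isUnionOf (signedCell-saturated S∈)
        ; intersections = λ S S∈ → saturated⇒isUnionOf
            λ p∈ q∈ k → signedCell-saturated (S∈ k) (p∈ k) q∈
        }

    -- For each column, containment says that the closed sectors of rows in `Φ` cover the cell. By
    -- `refinementCell-covered` one of them contains it, which gives the arc; the converse is
    -- immediate.
    covectorCell-⊆-thalf : ∀ {C} → C ∈ CovectorCell V → ∀ {Φ} → Decidable Φ →
                           C ⊆ thalf V Φ ⇔ NoIsolatedNode (Φ ∩ graph V C)
    covectorCell-⊆-thalf {C} (Z , Z⊂⊤ , D , D-cell@((w₀ , w₀∈D) , _) , C⊆ , ⊆C) {Φ} Φ? =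
      mk⇔ to from
      where
      from : NoIsolatedNode (Φ ∩ graph V C) → C ⊆ thalf V Φ
      from noIsolated p∈C j =
        let (i , i∈Φ , _ , C⊆S) = noIsolated j in (i , i∈Φ) , C⊆S p∈C
      to : C ⊆ thalf V Φ → NoIsolatedNode (Φ ∩ graph V C)
      to C⊆thalf j =
        let (i , i∈Φ , dom) = refinementCell-covered D-cell (λ i → Φ? (i , j)) j covered
        in i , i∈Φ , inSupp (dom w₀∈D) ,
           λ {p} p∈C → stratum⊆closedSector {D = D} dom p (C⊆ p∈C)
        where
        covered : ∀ {w} → w ∈ D → ∃[ i ] (i , j) ∈ Φ × Dominates (column V j) (extend Z w) i
        covered {w} w∈D =
          let p              = extend Z w , extend-≢∞ w Z⊂⊤
              ((i , i∈Φ) , p∈S) = C⊆thalf {p} (⊆C (extend Z w ,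
                (w , w∈D , λ _ → ≈⁺-refl refl) , ≋⇒∼ λ _ → ≈⁺-refl refl)) j
          in i , i∈Φ , closedSector⇒dominates p p∈S

corollary53 : (ℝ : RealNumbers) → let open Tropical ℝ in
    ∀ {d n : ℕ} (V : Matrix (Fin d) (Fin n)) →
    (∀ j → ¬ AllInfinite (column V j)) →
    (Ψ : Graph d n) → Decidable Ψ →
    GeneratesDecomposition (SignedCell V Ψ) (CovectorCell V) ×
    (∀ C → C ∈ CovectorCell V → ∀ (ε : Vector Sign n) →
    C ⊆ thalf V (signed Ψ ε) ⇔ NoIsolatedNode (signed Ψ ε ∩ graph V C))
corollary53 ℝ V V≢∞ Ψ Ψ? =
  signedCells-generate V V≢∞ Ψ? ,
  λ C C-cell ε → covectorCell-⊆-thalf V C-cell (signed? Ψ? ε)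
  where open Sectors ℝ
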